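{- Let $M$ be a matroid of rank $4$ on ground set $T$ that is OTE. Let $M_1,M_2$ be extensions of $M$ with ground sets $E_1,E_2$ and rank functions $\operatorname{rk}_1,\operatorname{rk}_2$, such that $E_1\cap E_2=T$, $E=E_1\cup E_2$, and all of these matroids have finite rank and finite or countably infinite ground sets. Then the proper amalgam of $M_1$ and $M_2$ along $M$ exists, i.e. the function $\xi$ defined below is submodular on all subsets of $E$ (and hence is the rank function of a matroid on $E$).
   Context: Let $\operatorname{rk}$ be the rank function of $M$. For $X\subseteq E$ put $\eta(X)=\operatorname{rk}_1(X\cap E_1)+\operatorname{rk}_2(X\cap E_2)-\operatorname{rk}(X\cap T)$ and $\xi(X)=\min\{\eta(Y): Y\supseteq X,\ Y\subseteq E\}$. If $\xi$ is submodular it is the rank function of an amalgam of $M_1$ and $M_2$ (a matroid on $E$ whose restriction to $E_i$ is $M_i$), called the proper amalgam. A modular cut of $M$ is a set $\mathcal{M}$ of flats such that any flat containing a member is a member, and $F_1\cap F_2\in\mathcal{M}$ whenever $F_1,F_2\in\mathcal{M}$ satisfy $\operatorname{rk}(F_1)+\operatorname{rk}(F_2)=\operatorname{rk}(F_1\cup F_2)+\operatorname{rk}(F_1\cap F_2)$. It is principal if it equals $\{G\text{ flat}: G\supseteq F\}$ for a flat $F$. $M$ is OTE if every nonempty modular cut is principal. -}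

module Defs where

open import Level using (0ℓ)
open import Data.Nat using (ℕ; zero; suc; _+_; _∸_; _≤_; _<_)
open import Data.Product using (Σ; _×_; _,_; ∃)
open import Data.List using (List)
open import Data.List.Membership.Propositional using () renaming (_∈_ to _∈L_)
open import Relation.Unary using (Pred; _∈_; _∉_; _⊆_; _∩_; _∪_; ∅; ｛_｝)
open import Relation.Binary.PropositionalEquality using (_≡_)
open import Function.Definitions using (Injective)

Subset : Set → Set₁
Subset U = Pred U 0ℓ

listSet : {U : Set} → List U → Subset U
listSet L = λ u → u ∈L L

Countable : Set → Set
Countable U = Σ (U → ℕ) (λ f → Injective _≡_ _≡_ f)

-- A matroid of finite rank on the ground set S ⊆ U, given by its rank
-- function (only its values on subsets of S matter).
record IsMatroid {U : Set} (S : Subset U) (r : Subset U → ℕ) : Set₁ where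
  field
    rk-empty   : r ∅ ≡ 0
    rk-mono    : ∀ X Y → X ⊆ S → Y ⊆ S → X ⊆ Y → r X ≤ r Y
    rk-unit    : ∀ X e → X ⊆ S → e ∈ S → r (X ∪ ｛ e ｝) ≤ suc (r X)
    rk-submod  : ∀ X Y → X ⊆ S → Y ⊆ S → r (X ∪ Y) + r (X ∩ Y) ≤ r X + r Y
    rk-finitary : ∀ X → X ⊆ S → ∃ λ (L : List U) → (listSet L ⊆ X) × (r (listSet L) ≡ r X)

FiniteRank : {U : Set} → Subset U → (Subset U → ℕ) → Set₁
FiniteRank {U} S r = ∃ λ (n : ℕ) → ∀ (X : Subset U) → X ⊆ S → r X ≤ n

IsExtension : {U : Set} → Subset U → (Subset U → ℕ) → Subset U → (Subset U → ℕ) → Set₁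
IsExtension {U} S r S₁ r₁ = (S ⊆ S₁) × (∀ (X : Subset U) → X ⊆ S → r₁ X ≡ r X)

IsFlat : {U : Set} → Subset U → (Subset U → ℕ) → Subset U → Set
IsFlat S r F = (F ⊆ S) × (∀ e → e ∈ S → e ∉ F → r F < r (F ∪ ｛ e ｝))

IsModularCut : {U : Set} → Subset U → (Subset U → ℕ) → (Subset U → Set) → Set₁
IsModularCut S r 𝓜 =
  (∀ F → 𝓜 F → IsFlat S r F)
  × (∀ F G → 𝓜 F → IsFlat S r G → F ⊆ G → 𝓜 G)
  × (∀ F₁ F₂ → 𝓜 F₁ → 𝓜 F₂ → r F₁ + r F₂ ≡ r (F₁ ∪ F₂) + r (F₁ ∩ F₂) → 𝓜 (F₁ ∩ F₂))

IsPrincipal : {U : Set} → Subset U → (Subset U → ℕ) → (Subset U → Set) → Set₁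
IsPrincipal S r 𝓜 = ∃ λ F → IsFlat S r F ×
  (∀ G → (𝓜 G → IsFlat S r G × F ⊆ G) × (IsFlat S r G → F ⊆ G → 𝓜 G))

IsOTE : {U : Set} → Subset U → (Subset U → ℕ) → Set₁
IsOTE {U} S r = ∀ (𝓜 : Subset U → Set) → IsModularCut S r 𝓜 → (∃ λ F → 𝓜 F) → IsPrincipal S r 𝓜

-- η(X) = rk₁(X∩E₁) + rk₂(X∩E₂) − rk(X∩T), with T = E₁ ∩ E₂.
-- (Truncated subtraction is exact here since rk(X∩T) ≤ rk₁(X∩E₁).)
η : {U : Set} (E₁ E₂ : Subset U) (rk rk₁ rk₂ : Subset U → ℕ) → Subset U → ℕ
η E₁ E₂ rk rk₁ rk₂ X = (rk₁ (X ∩ E₁) + rk₂ (X ∩ E₂)) ∸ rk (X ∩ (E₁ ∩ E₂))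

-- "ξ(X) = k": k is the minimum of η(Y) over all Y ⊇ X (Y ⊆ E = U).
IsXi : {U : Set} (E₁ E₂ : Subset U) (rk rk₁ rk₂ : Subset U → ℕ) → Subset U → ℕ → Set₁
IsXi {U} E₁ E₂ rk rk₁ rk₂ X k =
  (∃ λ (Y : Subset U) → X ⊆ Y × η E₁ E₂ rk rk₁ rk₂ Y ≡ k)
  × (∀ (Y : Subset U) → X ⊆ Y → k ≤ η E₁ E₂ rk rk₁ rk₂ Y)

XiSubmodular : {U : Set} (E₁ E₂ : Subset U) (rk rk₁ rk₂ : Subset U → ℕ) → Set₁
XiSubmodular {U} E₁ E₂ rk rk₁ rk₂ = ∀ (X Y : Subset U) (a b c d : ℕ) →
  IsXi E₁ E₂ rk rk₁ rk₂ X a → IsXi E₁ E₂ rk rk₁ rk₂ Y b →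
  IsXi E₁ E₂ rk rk₁ rk₂ (X ∪ Y) c → IsXi E₁ E₂ rk rk₁ rk₂ (X ∩ Y) d →
  c + d ≤ a + b

{-# OPTIONS --safe #-}
module Submission where

open import Defs
open import Data.Nat using (ℕ; zero; suc; _+_; _≤_; _<_; s≤s; _≤?_)
open import Data.Nat.Properties
open import Data.Nat.Tactic.RingSolver using (solve)
open import Data.Product using (_×_; _,_; ∃; proj₁; proj₂)
open import Data.Sum using (_⊎_; inj₁; inj₂; [_,_])
open import Data.List using (List; []; _∷_)
open import Data.List.Relation.Unary.Any using (here; there)
open import Data.Empty using (⊥)
open import Function using (_∘_)
open import Relation.Nullary using (¬_; Dec; yes; no; contradiction)
open import Relation.Unary using (_∈_; _⊆_; _∩_; _∪_; ｛_｝)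
open import Relation.Binary.PropositionalEquality using (_≡_; refl; sym; trans; cong; cong₂; subst; subst₂)

-- Enlarging a minimiser of η to a set closed in both M₁ and M₂ does not increase η, so let X and Y
-- be closed, with traces A = X ∩ T and B = Y ∩ T. Submodularity of η can only fail if (A , B) is a
-- nonmodular pair of M. Suppose also that (X ∩ Eⱼ , Y ∩ Eⱼ) is modular in Mⱼ, and contract
-- D = X ∩ Y ∩ Eⱼ. The flats of M on which this lowers the rank as much as on T form a modular cut;
-- if it contained A and B it would by OTE contain a flat inside A ∩ B, whose rank is too small.
-- Rank 4 leaves three cases: two disjoint coplanar lines, where D and the plane they span together
-- span T; a line and a plane that are disjoint, where the plane has rank 1 modulo D; and two planes,
-- which are impossible. If this happens on both sides, adding T to X ∪ Y (first case) or the plane to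
-- X ∩ Y (second case) lowers η by one, which is exactly the defect of (A , B).

-- Opaque because unfolding it would normalise the ring-solver equations passed to it.
opaque
  ≤-cancel : ∀ {p q x y} c → p ≤ q → p ≡ x + c → q ≡ y + c → x ≤ y
  ≤-cancel {x = x} {y} c p≤q refl refl = +-cancelʳ-≤ c x y p≤q

-- Span, flats and closure in one matroid.

module MatroidProperties {U : Set} {S : Subset U} {r : Subset U → ℕ} (M : IsMatroid S r) where
  open IsMatroid M

  rk-submod-⊆ : ∀ {X Y P Q} → X ⊆ S → Y ⊆ S → P ⊆ X ∪ Y → Q ⊆ X ∩ Y →
                r P + r Q ≤ r X + r Y
  rk-submod-⊆ {X} {Y} {P} {Q} X⊆S Y⊆S P⊆ Q⊆ = ≤-trans
    (+-mono-≤ (rk-mono P (X ∪ Y) (∪⊆S ∘ P⊆) ∪⊆S P⊆)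
              (rk-mono Q (X ∩ Y) (X⊆S ∘ proj₁ ∘ Q⊆) (X⊆S ∘ proj₁) Q⊆))
    (rk-submod X Y X⊆S Y⊆S)
    where
    ∪⊆S : X ∪ Y ⊆ S
    ∪⊆S = [ X⊆S , Y⊆S ]

  rk-mono-⊆ : ∀ {X Y} → Y ⊆ S → X ⊆ Y → r X ≤ r Y
  rk-mono-⊆ Y⊆S X⊆Y = rk-mono _ _ (Y⊆S ∘ X⊆Y) Y⊆S X⊆Y

  ∪｛｝⊆S : ∀ {X : Subset U} {e} → X ⊆ S → e ∈ S → X ∪ ｛ e ｝ ⊆ S
  ∪｛｝⊆S X⊆S e∈S = [ X⊆S , (λ { refl → e∈S }) ]

  spanned-⊆ : ∀ {X Y e} → X ⊆ Y → Y ⊆ S → e ∈ S →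
              r (X ∪ ｛ e ｝) ≤ r X → r (Y ∪ ｛ e ｝) ≤ r Y
  spanned-⊆ {X} {Y} {e} X⊆Y Y⊆S e∈S e≤ = +-cancelʳ-≤ (r X) _ _ (≤-trans
    (rk-submod-⊆ Y⊆S (∪｛｝⊆S (Y⊆S ∘ X⊆Y) e∈S)
      [ inj₁ , inj₂ ∘ inj₂ ] (λ x → X⊆Y x , inj₁ x))
    (+-monoʳ-≤ (r Y) e≤))

  rk-spanned-list : ∀ {X} → X ⊆ S → (L : List U) →
    (∀ {e} → e ∈ listSet L → e ∈ S × r (X ∪ ｛ e ｝) ≤ r X) → r (X ∪ listSet L) ≤ r X
  rk-spanned-list X⊆S [] _ = rk-mono-⊆ X⊆S [ (λ x → x) , (λ ()) ]
  rk-spanned-list {X} X⊆S (e ∷ L) spans = ≤-trans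
    (rk-mono-⊆ (∪｛｝⊆S XL⊆S e∈S) λ where
      (inj₁ x) → inj₁ (inj₁ x)
      (inj₂ (here refl)) → inj₂ refl
      (inj₂ (there l)) → inj₁ (inj₂ l))
    (≤-trans (spanned-⊆ {X = X} inj₁ XL⊆S e∈S (proj₂ (spans (here refl))))
             (rk-spanned-list X⊆S L (spans ∘ there)))
    where
    e∈S : e ∈ S
    e∈S = proj₁ (spans (here refl))
    XL⊆S : X ∪ listSet L ⊆ S
    XL⊆S = [ X⊆S , proj₁ ∘ spans ∘ there ]

  -- By finitarity a finite list inside `Y` already has rank `r Y`; its elements can be adjoined to
  -- `X` one at a time at no cost.
  rk-spanned : ∀ {X Y} → X ⊆ S → Y ⊆ S →
    (∀ {e} → e ∈ Y → r (X ∪ ｛ e ｝) ≤ r X) → r Y ≤ r X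
  rk-spanned {X} {Y} X⊆S Y⊆S spans =
    let L , L⊆Y , rL≡rY = rk-finitary Y Y⊆S in
    subst (_≤ r X) rL≡rY (≤-trans
      (rk-mono-⊆ [ X⊆S , Y⊆S ∘ L⊆Y ] inj₂)
      (rk-spanned-list X⊆S L (λ l → Y⊆S (L⊆Y l) , spans (L⊆Y l))))

  ∩-isFlat : ∀ {F G} → IsFlat S r F → IsFlat S r G → IsFlat S r (F ∩ G)
  ∩-isFlat {F} {G} (F⊆S , flatF) (G⊆S , flatG) = F⊆S ∘ proj₁ , λ e e∈S e∉ → ≰⇒> λ e≤ →
    <⇒≱ (flatF e e∈S λ e∈F → <⇒≱ (flatG e e∈S λ e∈G → e∉ (e∈F , e∈G))
        (spanned-⊆ {X = F ∩ G} proj₂ G⊆S e∈S e≤))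
      (spanned-⊆ {X = F ∩ G} proj₁ F⊆S e∈S e≤)

-- `X` may stick out of `E`; only its trace on `E` is tested, so that one subset of `U` can be
-- closed in both extensions.
Closed : {U : Set} → Subset U → (Subset U → ℕ) → Subset U → Set
Closed E r X = ∀ {e} → e ∈ E → r ((X ∩ E) ∪ ｛ e ｝) ≤ r (X ∩ E) → e ∈ X

closure : {U : Set} → Subset U → (Subset U → ℕ) → Subset U → Subset U
closure E r X = X ∪ (λ e → e ∈ E × r ((X ∩ E) ∪ ｛ e ｝) ≤ r (X ∩ E))

-- Arithmetic of the rank inequalities.

cut-arithmetic : ∀ t sT {s₁ s₂ s∪ s∩ r₁ r₂ r∪ r∩} →
  t + s₁ ≤ r₁ + sT → t + s₂ ≤ r₂ + sT → r₁ + r₂ ≡ r∪ + r∩ →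
  s∪ + s∩ ≤ s₁ + s₂ → sT + r∪ ≤ s∪ + t → t + s∩ ≤ r∩ + sT
cut-arithmetic t sT {s₁} {s₂} {s∪} {s∩} {r₁} {r₂} {r∪} {r∩} h₁ h₂ eq sub quo =
  ≤-cancel (t + s₁ + s₂ + s∪ + r∪ + sT + r₁ + r₂)
    (+-mono-≤ (+-mono-≤ h₁ h₂) (+-mono-≤ (+-mono-≤ sub quo) (≤-reflexive eq)))
    (solve (t ∷ sT ∷ s₁ ∷ s₂ ∷ s∪ ∷ s∩ ∷ r₁ ∷ r₂ ∷ r∪ ∷ []))
    (solve (t ∷ sT ∷ s₁ ∷ s₂ ∷ s∪ ∷ s∩ ∷ r₁ ∷ r₂ ∷ r∪ ∷ r∩ ∷ []))

skew-arithmetic : ∀ {x y xy d sA sB sU} w → x + y ≤ xy + d →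
  w + sA ≤ x + sU → xy + sB ≤ y + w → sA + sB ≤ sU + d
skew-arithmetic {x} {y} {xy} {d} {sA} {sB} {sU} w mod h₁ h₂ =
  ≤-cancel (w + xy + x + y) (+-mono-≤ mod (+-mono-≤ h₁ h₂))
    (solve (x ∷ y ∷ xy ∷ d ∷ sA ∷ sB ∷ sU ∷ w ∷ []))
    (solve (x ∷ y ∷ xy ∷ d ∷ sA ∷ sB ∷ sU ∷ w ∷ []))

-- The ranks of A, B, A ∪ B and A ∩ B for a nonmodular pair of flats in rank 4.
data Shape : (a b u i : ℕ) → Set where
  lines      : Shape 2 2 3 0
  line-plane : Shape 2 3 4 0
  plane-line : Shape 3 2 4 0
  planes     : ∀ {i} → i ≤ 1 → Shape 3 3 4 i

-- Combining `b < u` with `u + i < a + b` gives `2 + i ≤ a`, and likewise for `b`; so both ranks are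
-- 2 or 3, and `u` and `i` are then squeezed.
nonmodular-shape : ∀ {a b u i} → a < u → b < u → u ≤ 4 → u + i < a + b → Shape a b u i
nonmodular-shape {a} {b} {u} {i} a<u b<u u≤4 u+i<a+b =
  go (2-or-3 2≤a (≤-pred (≤-trans a<u u≤4))) (2-or-3 2≤b (≤-pred (≤-trans b<u u≤4))) a<u b<u u≤4 u+i<a+b
  where
  2≤a : 2 ≤ a
  2≤a = m+n≤o⇒m≤o 2 {i} (≤-cancel (b + u) (+-mono-≤ b<u u+i<a+b)
    (solve (b ∷ u ∷ i ∷ [])) (solve (a ∷ b ∷ u ∷ [])))
  2≤b : 2 ≤ b
  2≤b = m+n≤o⇒m≤o 2 {i} (≤-cancel (a + u) (+-mono-≤ a<u u+i<a+b)
    (solve (a ∷ u ∷ i ∷ [])) (solve (a ∷ b ∷ u ∷ [])))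

  2-or-3 : ∀ {n} → 2 ≤ n → n ≤ 3 → n ≡ 2 ⊎ n ≡ 3
  2-or-3 {2} _ _ = inj₁ refl
  2-or-3 {3} _ _ = inj₂ refl
  2-or-3 {1} (s≤s ()) _
  2-or-3 {suc (suc (suc (suc n)))} _ (s≤s (s≤s (s≤s ())))

  go : ∀ {a b} → a ≡ 2 ⊎ a ≡ 3 → b ≡ 2 ⊎ b ≡ 3 →
    a < u → b < u → u ≤ 4 → u + i < a + b → Shape a b u i
  go (inj₁ refl) (inj₁ refl) 3≤u _ _ u+i<4
    with refl ← ≤-antisym (m+n≤o⇒m≤o u (≤-pred u+i<4)) 3≤u
    with refl ← n≤0⇒n≡0 (+-cancelˡ-≤ 3 i 0 (≤-pred u+i<4)) = lines
  go (inj₁ refl) (inj₂ refl) _ 4≤u u≤4 u+i<5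
    with refl ← ≤-antisym u≤4 4≤u
    with refl ← n≤0⇒n≡0 (+-cancelˡ-≤ 4 i 0 (≤-pred u+i<5)) = line-plane
  go (inj₂ refl) (inj₁ refl) 4≤u _ u≤4 u+i<5
    with refl ← ≤-antisym u≤4 4≤u
    with refl ← n≤0⇒n≡0 (+-cancelˡ-≤ 4 i 0 (≤-pred u+i<5)) = plane-line
  go (inj₂ refl) (inj₂ refl) 4≤u _ u≤4 u+i<6
    with refl ← ≤-antisym u≤4 4≤u = planes (+-cancelˡ-≤ 4 i 1 (≤-pred u+i<6))

-- sA, sB, sU, sT are the ranks of A, B, A ∪ B, T joined with D, and d is the rank of D.
Collapse : ∀ {a b u i} → Shape a b u i → (sA sB sU sT d : ℕ) → Set
Collapse lines      sA sB sU sT d = sT ≤ sU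
Collapse line-plane sA sB sU sT d = sB ≤ 1 + d
Collapse plane-line sA sB sU sT d = sA ≤ 1 + d
Collapse (planes _) sA sB sU sT d = ⊥

-- If the collapse failed, the last hypothesis would apply and give `4 + d ≤ i + sT`. Then `qT`
-- makes `sU - d` at least `u - i`, while `qA`, `qB` and `skew` make it at most `2u - a - b`,
-- against the nonmodularity of the pair.
collapse : ∀ {a b u i sA sB sU sT d} (sh : Shape a b u i) →
  (sA ≤ d → a ≤ i) → (sB ≤ d → b ≤ i) → sA + sB ≤ sU + d →
  sU + a ≤ sA + u → sU + b ≤ sB + u → sT + u ≤ sU + 4 → sU ≤ sT →
  (4 + sA ≤ a + sT → 4 + sB ≤ b + sT → 4 + d ≤ i + sT) →
  Collapse sh sA sB sU sT d
collapse {sA = sA} {sB} {sU} {sT} {d} lines A≰D B≰D skew qA qB qT U≤T cut with sT ≤? sU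
... | yes T≤U = T≤U
... | no  T≰U = contradiction (≤-cancel {x = 1} {0} (10 + d + sT + sU + sU + sA + sB)
    (+-mono-≤ (+-mono-≤ (cut cutA cutB) qT) (+-mono-≤ (+-mono-≤ qA qB) skew))
    (solve (sA ∷ sB ∷ sU ∷ sT ∷ d ∷ [])) (solve (sA ∷ sB ∷ sU ∷ sT ∷ d ∷ []))) (λ ())
  where
  d<sA : d < sA
  d<sA = ≰⇒> (λ sA≤d → contradiction (A≰D sA≤d) λ ())
  d<sB : d < sB
  d<sB = ≰⇒> (λ sB≤d → contradiction (B≰D sB≤d) λ ())
  -- One of the two units comes from `d<sB`, the other from the failure of `sT ≤ sU`.
  cutA : 4 + sA ≤ 2 + sT
  cutA = ≤-cancel (sB + d + sU) (+-mono-≤ (+-mono-≤ skew (+-mono-≤ (≤-refl {2}) d<sB)) (≰⇒> T≰U))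
    (solve (sA ∷ sB ∷ sU ∷ d ∷ [])) (solve (sB ∷ sU ∷ sT ∷ d ∷ []))
  cutB : 4 + sB ≤ 2 + sT
  cutB = ≤-cancel (sA + d + sU) (+-mono-≤ (+-mono-≤ skew (+-mono-≤ (≤-refl {2}) d<sA)) (≰⇒> T≰U))
    (solve (sA ∷ sB ∷ sU ∷ d ∷ [])) (solve (sA ∷ sU ∷ sT ∷ d ∷ []))
collapse {sA = sA} {sB} {sU} {sT} {d} line-plane A≰D B≰D skew qA qB qT U≤T cut with sB ≤? 1 + d
... | yes B≤ = B≤
... | no  B≰ = contradiction (≤-cancel {x = 1} {0} (12 + d + sT + sU + sU + sA + sB)
    (+-mono-≤ (+-mono-≤ (cut cutA cutB) qT) (+-mono-≤ (+-mono-≤ qA qB) skew))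
    (solve (sA ∷ sB ∷ sU ∷ sT ∷ d ∷ [])) (solve (sA ∷ sB ∷ sU ∷ sT ∷ d ∷ []))) (λ ())
  where
  d<sA : d < sA
  d<sA = ≰⇒> (λ sA≤d → contradiction (A≰D sA≤d) λ ())
  -- Failure of `sB ≤ 1 + d` yields both units at once; `cutB` takes its single unit from `d<sA`.
  cutA : 4 + sA ≤ 2 + sT
  cutA = ≤-cancel (sB + d + sU) (+-mono-≤ (+-mono-≤ skew (+-mono-≤ (≤-refl {2}) (≰⇒> B≰))) U≤T)
    (solve (sA ∷ sB ∷ sU ∷ d ∷ [])) (solve (sB ∷ sU ∷ sT ∷ d ∷ []))
  cutB : 4 + sB ≤ 3 + sT
  cutB = ≤-cancel (sA + d + sU) (+-mono-≤ (+-mono-≤ skew (+-mono-≤ (≤-refl {3}) d<sA)) U≤T)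
    (solve (sA ∷ sB ∷ sU ∷ d ∷ [])) (solve (sA ∷ sU ∷ sT ∷ d ∷ []))
collapse {sA = sA} {sB} {sU} {d = d} plane-line A≰D B≰D skew qA qB qT U≤T cut =
  collapse {sA = sB} {sA} line-plane B≰D A≰D (subst (_≤ sU + d) (+-comm sA sB) skew)
    qB qA qT U≤T (λ cutB cutA → cut cutA cutB)
collapse {i = i} {sA} {sB} {sU} {sT} {d} (planes i≤1) A≰D B≰D skew qA qB qT U≤T cut =
  contradiction (≤-cancel {x = 1} {0} (13 + i + d + sT + sU + sU + sA + sB)
    (+-mono-≤ (+-mono-≤ (+-mono-≤ (cut cutA cutB) qT) (+-mono-≤ (+-mono-≤ qA qB) skew)) i≤1)
    (solve (i ∷ sA ∷ sB ∷ sU ∷ sT ∷ d ∷ [])) (solve (i ∷ sA ∷ sB ∷ sU ∷ sT ∷ d ∷ []))) (λ ())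
  where
  3≰i : ¬ 3 ≤ i
  3≰i 3≤i = contradiction (≤-trans 3≤i i≤1) λ { (s≤s ()) }
  d<sA : d < sA
  d<sA = ≰⇒> (λ sA≤d → 3≰i (A≰D sA≤d))
  d<sB : d < sB
  d<sB = ≰⇒> (λ sB≤d → 3≰i (B≰D sB≤d))
  -- Each cut costs one unit, which `d<sB` and `d<sA` supply outright, so this shape cannot occur.
  cutA : 4 + sA ≤ 3 + sT
  cutA = ≤-cancel (sB + d + sU) (+-mono-≤ (+-mono-≤ skew (+-mono-≤ (≤-refl {3}) d<sB)) U≤T)
    (solve (sA ∷ sB ∷ sU ∷ d ∷ [])) (solve (sB ∷ sU ∷ sT ∷ d ∷ []))
  cutB : 4 + sB ≤ 3 + sT
  cutB = ≤-cancel (sA + d + sU) (+-mono-≤ (+-mono-≤ skew (+-mono-≤ (≤-refl {3}) d<sA)) U≤T)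
    (solve (sA ∷ sB ∷ sU ∷ d ∷ [])) (solve (sA ∷ sU ∷ sT ∷ d ∷ []))

deficit≤2 : ∀ {a b u i} → Shape a b u i → a + b ≤ u + i + 2
deficit≤2 lines          = m≤m+n 4 1
deficit≤2 line-plane     = m≤m+n 5 1
deficit≤2 plane-line     = m≤m+n 5 1
deficit≤2 (planes {i} _) = +-monoˡ-≤ 2 (m≤m+n 4 i)

-- Only two disjoint planes have defect 2, and for `planes` the collapse is empty.
collapse⇒deficit≤1 : ∀ {a b u i sA sB sU sT d} (sh : Shape a b u i) →
  Collapse sh sA sB sU sT d → a + b ≤ u + i + 1
collapse⇒deficit≤1 lines      _ = ≤-refl
collapse⇒deficit≤1 line-plane _ = ≤-refl
collapse⇒deficit≤1 plane-line _ = ≤-refl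

-- `k` bounds the defect of the trace pair. As η subtracts trace ranks, it suffices that the rank
-- sums of the extensions leave `k` to spare.
η-balance : ∀ k {a b u i ηX ηY x₁ x₂ y₁ y₂ c e} → a + b ≤ u + i + k →
  ηX + a ≡ x₁ + x₂ → ηY + b ≡ y₁ + y₂ →
  (c + u) + (e + i) + k ≤ (x₁ + y₁) + (x₂ + y₂) → c + e ≤ ηX + ηY
η-balance k {a} {b} {u} {i} {ηX} {ηY} {x₁} {x₂} {y₁} {y₂} {c} {e} deficit eqX eqY h =
  ≤-cancel (a + b + u + i + k + x₁ + x₂ + y₁ + y₂)
    (+-mono-≤ (+-mono-≤ deficit h) (≤-reflexive (cong₂ _+_ (sym eqX) (sym eqY))))
    (solve (k ∷ a ∷ b ∷ u ∷ i ∷ x₁ ∷ x₂ ∷ y₁ ∷ y₂ ∷ c ∷ e ∷ []))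
    (solve (k ∷ a ∷ b ∷ u ∷ i ∷ ηX ∷ ηY ∷ x₁ ∷ x₂ ∷ y₁ ∷ y₂ ∷ []))

-- The extra unit comes from testing a larger set: for `lines` the subtracted trace rank grows from
-- 3 to 4 for free; otherwise it grows from 0 to 3 while each extension rank grows by at most 1.
collapsed-gain : ∀ {a b u i c e p₁ p₂ d₁ d₂ sA₁ sA₂ sB₁ sB₂ sU₁ sU₂ sT₁ sT₂} (sh : Shape a b u i) →
  Collapse sh sA₁ sB₁ sU₁ sT₁ d₁ → Collapse sh sA₂ sB₂ sU₂ sT₂ d₂ →
  c + u ≤ p₁ + p₂ → e + i ≤ d₁ + d₂ →
  (sT₁ ≤ sU₁ → sT₂ ≤ sU₂ → c + 4 ≤ p₁ + p₂) → e + a ≤ sA₁ + sA₂ → e + b ≤ sB₁ + sB₂ →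
  (c + u) + (e + i) + 1 ≤ (p₁ + d₁) + (p₂ + d₂)
collapsed-gain {c = c} {e} {p₁} {p₂} {d₁} {d₂} lines T≤₁ T≤₂ hU hI gainT gainA gainB =
  ≤-cancel 0 (+-mono-≤ (gainT T≤₁ T≤₂) hI)
    (solve (c ∷ e ∷ [])) (solve (p₁ ∷ p₂ ∷ d₁ ∷ d₂ ∷ []))
collapsed-gain {c = c} {e} {p₁} {p₂} {d₁} {d₂} {sB₁ = sB₁} {sB₂} line-plane B≤₁ B≤₂ hU hI gainT gainA gainB =
  ≤-cancel (2 + sB₁ + sB₂) (+-mono-≤ (+-mono-≤ hU gainB) (+-mono-≤ B≤₁ B≤₂))
    (solve (c ∷ e ∷ sB₁ ∷ sB₂ ∷ [])) (solve (p₁ ∷ p₂ ∷ d₁ ∷ d₂ ∷ sB₁ ∷ sB₂ ∷ []))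
collapsed-gain {c = c} {e} {p₁} {p₂} {d₁} {d₂} {sA₁} {sA₂} plane-line A≤₁ A≤₂ hU hI gainT gainA gainB =
  ≤-cancel (2 + sA₁ + sA₂) (+-mono-≤ (+-mono-≤ hU gainA) (+-mono-≤ A≤₁ A≤₂))
    (solve (c ∷ e ∷ sA₁ ∷ sA₂ ∷ [])) (solve (p₁ ∷ p₂ ∷ d₁ ∷ d₂ ∷ sA₁ ∷ sA₂ ∷ []))

modular-gain : ∀ {c u e i p₁ p₂ d₁ d₂ m₁ m₂ n₁ n₂} → c + u ≤ p₁ + p₂ → e + i ≤ d₁ + d₂ →
  n₁ + (p₁ + d₁) ≤ m₁ → n₂ + (p₂ + d₂) ≤ m₂ → (c + u) + (e + i) + (n₁ + n₂) ≤ m₁ + m₂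
modular-gain {c} {u} {e} {i} {p₁} {p₂} {d₁} {d₂} {m₁} {m₂} {n₁} {n₂} hU hI h₁ h₂ =
  ≤-cancel (p₁ + p₂ + d₁ + d₂) (+-mono-≤ (+-mono-≤ hU hI) (+-mono-≤ h₁ h₂))
    (solve (c ∷ u ∷ e ∷ i ∷ p₁ ∷ p₂ ∷ d₁ ∷ d₂ ∷ n₁ ∷ n₂ ∷ []))
    (solve (p₁ ∷ p₂ ∷ d₁ ∷ d₂ ∷ m₁ ∷ m₂ ∷ []))

-- One extension: traces on `T` and closures.

module Extension {U : Set} {T E : Subset U} {r rᴱ : Subset U → ℕ}
  (M : IsMatroid T r) (N : IsMatroid E rᴱ) (ext : IsExtension T r E rᴱ) where

  private
    module M = MatroidProperties M
    module N = MatroidProperties N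
    T⊆E = proj₁ ext

  rᴱ≡r : ∀ {X} → X ⊆ T → rᴱ X ≡ r X
  rᴱ≡r {X} = proj₂ ext X

  rk-trace-≤ : ∀ X → r (X ∩ T) ≤ rᴱ (X ∩ E)
  rk-trace-≤ X = subst (_≤ rᴱ (X ∩ E)) (rᴱ≡r proj₂)
    (N.rk-mono-⊆ proj₂ λ (x , t) → x , T⊆E t)

  closed-spanned : ∀ {X F e} → Closed E rᴱ X → F ⊆ X ∩ E → e ∈ E →
    rᴱ (F ∪ ｛ e ｝) ≤ rᴱ F → e ∈ X
  closed-spanned closed F⊆X e∈E e≤ = closed e∈E (N.spanned-⊆ F⊆X proj₂ e∈E e≤)

  closed-spanned-trace : ∀ {X F e} → Closed E rᴱ X → F ⊆ X ∩ T → e ∈ T →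
    r (F ∪ ｛ e ｝) ≤ r F → e ∈ X
  closed-spanned-trace {X} {F} {e} closed F⊆X e∈T e≤ =
    closed-spanned {F = F} closed ((λ (x , t) → x , T⊆E t) ∘ F⊆X) (T⊆E e∈T)
      (subst₂ _≤_ (sym (rᴱ≡r (M.∪｛｝⊆S F⊆T e∈T))) (sym (rᴱ≡r F⊆T)) e≤)
    where
    F⊆T : F ⊆ T
    F⊆T = proj₂ ∘ F⊆X

  trace-isFlat : ∀ {X} → Closed E rᴱ X → IsFlat T r (X ∩ T)
  trace-isFlat {X} closed = proj₂ , λ e e∈T e∉ → ≰⇒> λ e≤ →
    e∉ (closed-spanned-trace {F = X ∩ T} closed (λ x → x) e∈T e≤ , e∈T)

  -- The trace of `Y` is a flat, so if it spans the trace of `X` it contains it.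
  spanned-trace-⊆ : ∀ {X Y} → Closed E rᴱ Y →
    r ((X ∪ Y) ∩ T) ≤ r (Y ∩ T) → r (X ∩ T) ≤ r ((X ∩ Y) ∩ T)
  spanned-trace-⊆ {X} {Y} closed u≤ = M.rk-mono-⊆ proj₂ λ (x , t) →
    (x , closed-spanned-trace {F = Y ∩ T} closed (λ p → p) t
      (≤-trans (M.rk-mono-⊆ proj₂ λ { (inj₁ (y , t)) → inj₂ y , t ; (inj₂ refl) → inj₁ x , t }) u≤)) , t

  closure-closed : ∀ X → rᴱ (closure E rᴱ X ∩ E) ≤ rᴱ (X ∩ E) → Closed E rᴱ (closure E rᴱ X)
  closure-closed X c≤ {e} e∈E e≤ = inj₂ (e∈E , ≤-trans
    (N.rk-mono-⊆ (N.∪｛｝⊆S {X = closure E rᴱ X ∩ E} proj₂ e∈E)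
      (λ { (inj₁ (x , e)) → inj₁ (inj₁ x , e) ; (inj₂ q) → inj₂ q }))
    (≤-trans e≤ c≤))

  rk-closure : ∀ X → rᴱ (closure E rᴱ X ∩ E) ≤ rᴱ (X ∩ E)
  rk-closure X = N.rk-spanned proj₂ proj₂ λ where
    (inj₁ x , e∈E) → N.rk-mono-⊆ proj₂ [ (λ p → p) , (λ { refl → x , e∈E }) ]
    (inj₂ (_ , e≤) , _) → e≤

  Closed-⊆ : ∀ {X Y} → X ⊆ Y → rᴱ (Y ∩ E) ≤ rᴱ (X ∩ E) → Closed E rᴱ X → Closed E rᴱ Y
  Closed-⊆ {X} {Y} X⊆Y rY≤ closed e∈E e≤ = X⊆Y (closed e∈E (≤-trans
    (N.rk-mono-⊆ (N.∪｛｝⊆S {X = Y ∩ E} proj₂ e∈E)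
      (λ { (inj₁ (x , e)) → inj₁ (X⊆Y x , e) ; (inj₂ q) → inj₂ q }))
    (≤-trans e≤ rY≤)))

  -- Closing in `E′` adds only elements of `T` to `X ∩ E`. By submodularity the rank there grows no
  -- more than the trace rank, which η subtracts.
  rk-closure-other : ∀ {E′ r′} → (∀ {e} → e ∈ E → e ∈ E′ → e ∈ T) → ∀ X →
    rᴱ (closure E′ r′ X ∩ E) + r (X ∩ T) ≤ rᴱ (X ∩ E) + r (closure E′ r′ X ∩ T)
  rk-closure-other {E′} {r′} ∩⊆T X = subst₂ (λ m n → rᴱ (V ∩ E) + m ≤ rᴱ (X ∩ E) + n)
      (rᴱ≡r proj₂) (rᴱ≡r proj₂)
      (N.rk-submod-⊆ proj₂ (T⊆E ∘ proj₂)
        (λ { (inj₁ x , e) → inj₁ (x , e) ; (inj₂ c , e) → inj₂ (inj₂ c , ∩⊆T e (proj₁ c)) })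
        (λ (x , t) → (x , T⊆E t) , (inj₁ x , t)))
    where
    V = closure E′ r′ X

  -- Contracting the common part of two closed sets.

  module Pair (X Y : Subset U) (closedX : Closed E rᴱ X) (closedY : Closed E rᴱ Y) where
    D : Subset U
    D = (X ∩ Y) ∩ E

    -- Up to the constant `rᴱ D`, this is the rank function of the contraction by `D`.
    s : Subset U → ℕ
    s F = rᴱ (F ∪ D)

    ∪D⊆E : ∀ {F : Subset U} → F ⊆ T → F ∪ D ⊆ E
    ∪D⊆E F⊆T = [ T⊆E ∘ F⊆T , proj₂ ]

    s≥rD : ∀ {F} → F ⊆ T → rᴱ D ≤ s F
    s≥rD F⊆T = N.rk-mono-⊆ (∪D⊆E F⊆T) inj₂

    -- Contraction is a quotient: the loss `r - s` is monotone.
    s-quotient : ∀ {F G} → F ⊆ G → G ⊆ T → s G + r F ≤ s F + r G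
    s-quotient {F} {G} F⊆G G⊆T =
      subst₂ (λ m n → s G + m ≤ s F + n) (rᴱ≡r (G⊆T ∘ F⊆G)) (rᴱ≡r G⊆T)
        (N.rk-submod-⊆ (∪D⊆E (G⊆T ∘ F⊆G)) (T⊆E ∘ G⊆T)
          [ inj₂ , inj₁ ∘ inj₂ ] (λ f → inj₁ f , F⊆G f))

    -- Elements of rank 0 modulo `D` are spanned by `D`, hence lie in both closed sets.
    s-trace-≤ : ∀ {Z : Subset U} → s (Z ∩ T) ≤ rᴱ D → r (Z ∩ T) ≤ r ((X ∩ Y) ∩ T)
    s-trace-≤ {Z} s≤ = M.rk-mono-⊆ proj₂ λ z@(_ , t) →
      (closed-spanned {F = D} closedX (λ ((x , _) , e) → x , e) (T⊆E t) (spanned z)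
      , closed-spanned {F = D} closedY (λ ((_ , y) , e) → y , e) (T⊆E t) (spanned z)) , t
      where
      spanned : ∀ {e} → e ∈ Z ∩ T → rᴱ (D ∪ ｛ e ｝) ≤ rᴱ D
      spanned z = ≤-trans
        (N.rk-mono-⊆ (∪D⊆E {Z ∩ T} proj₂) [ inj₂ , (λ { refl → inj₁ z }) ]) s≤

    -- A modular pair is skew modulo `D`, and skewness passes to subsets: first `Y ∩ E` shrinks to
    -- its trace, then `X ∩ E`. The set in between is `(X ∩ E) ∪ (Y ∩ T)`.
    s-skew : rᴱ (X ∩ E) + rᴱ (Y ∩ E) ≤ rᴱ ((X ∪ Y) ∩ E) + rᴱ D →
      s (X ∩ T) + s (Y ∩ T) ≤ s ((X ∪ Y) ∩ T) + rᴱ D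
    s-skew modular = skew-arithmetic (rᴱ ((X ∩ E) ∪ (Y ∩ T))) modular
      (N.rk-submod-⊆ proj₂ (∪D⊆E {(X ∪ Y) ∩ T} proj₂)
        (λ { (inj₁ x) → inj₁ x ; (inj₂ (y , t)) → inj₂ (inj₁ (inj₂ y , t)) })
        (λ { (inj₁ (x , t)) → (x , T⊆E t) , inj₁ (inj₁ x , t)
           ; (inj₂ d@((x , _) , e)) → (x , e) , inj₂ d }))
      (N.rk-submod-⊆ proj₂ [ proj₂ , T⊆E ∘ proj₂ ]
        (λ { (inj₁ x , e) → inj₂ (inj₁ (x , e)) ; (inj₂ y , e) → inj₁ (y , e) })
        (λ { (inj₁ (y , t)) → (y , T⊆E t) , inj₂ (y , t)
           ; (inj₂ ((x , y) , e)) → (y , e) , inj₁ (x , e) }))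

    -- Submodularity of `(X ∪ Y) ∩ E` and `T ∪ D`; when `s T ≤ s ((X ∪ Y) ∩ T)`, adding `T` is free.
    rk-∪-T : rᴱ ((X ∪ Y ∪ T) ∩ E) + s ((X ∪ Y) ∩ T) ≤ rᴱ ((X ∪ Y) ∩ E) + s T
    rk-∪-T = N.rk-submod-⊆ proj₂ (∪D⊆E (λ t → t))
      (λ { (inj₁ x , e) → inj₁ (inj₁ x , e)
         ; (inj₂ (inj₁ y) , e) → inj₁ (inj₂ y , e)
         ; (inj₂ (inj₂ t) , e) → inj₂ (inj₁ t) })
      (λ { (inj₁ (z , t)) → (z , T⊆E t) , inj₁ t
         ; (inj₂ d@((x , _) , e)) → (inj₁ x , e) , inj₂ d })

    rk-∩-∪ : ∀ {F} → F ⊆ T → rᴱ (((X ∩ Y) ∪ F) ∩ E) ≤ s F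
    rk-∩-∪ F⊆T = N.rk-mono-⊆ (∪D⊆E F⊆T) λ where
      (inj₁ xy , e) → inj₂ (xy , e)
      (inj₂ f , e) → inj₁ f

    -- The flats on which contracting D lowers the rank as much as it does on T.
    Cut : Subset U → Set
    Cut F = IsFlat T r F × r T + s F ≤ r F + s T

    -- Members are the flats where the monotone loss `r - s` reaches its value at `T`. On a modular
    -- pair `r - s` is supermodular, and the union cannot exceed the maximum, so the intersection
    -- attains it.
    Cut-isModularCut : IsModularCut T r Cut
    Cut-isModularCut = (λ F → proj₁)
      , (λ F G (_ , cutF) flatG F⊆G → flatG , upward (s F) (s G) (r F) (s-quotient F⊆G (proj₁ flatG)) cutF)
      , λ F G (flatF , cutF) (flatG , cutG) modular →
          M.∩-isFlat flatF flatG ,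
          cut-arithmetic (r T) (s T) cutF cutG modular
            (N.rk-submod-⊆ (∪D⊆E (proj₁ flatF)) (∪D⊆E (proj₁ flatG))
              (λ { (inj₁ (inj₁ f)) → inj₁ (inj₁ f) ; (inj₁ (inj₂ g)) → inj₂ (inj₁ g)
                 ; (inj₂ d) → inj₁ (inj₂ d) })
              [ (λ (f , g) → inj₁ f , inj₁ g) , (λ d → inj₂ d , inj₂ d) ])
            (s-quotient [ proj₁ flatF , proj₁ flatG ] (λ t → t))
      where
      upward : ∀ {t sT} sF sG rF {rG} → sG + rF ≤ sF + rG → t + sF ≤ rF + sT → t + sG ≤ rG + sT
      upward {t} {sT} sF sG rF {rG} quo cut = ≤-cancel (rF + sF) (+-mono-≤ quo cut)
        (solve (t ∷ sF ∷ sG ∷ rF ∷ [])) (solve (sT ∷ sF ∷ rF ∷ rG ∷ []))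

    -- The generator of the cut lies in both traces, so its `r`-rank is at most that of their
    -- intersection, while its `s`-rank is at least `rᴱ D`.
    OTE⇒cut-bound : IsOTE T r →
      r T + s (X ∩ T) ≤ r (X ∩ T) + s T → r T + s (Y ∩ T) ≤ r (Y ∩ T) + s T →
      r T + rᴱ D ≤ r ((X ∩ Y) ∩ T) + s T
    OTE⇒cut-bound ote cutX cutY =
      let F , flatF , principal = ote Cut Cut-isModularCut (X ∩ T , trace-isFlat closedX , cutX)
          F⊆X = proj₂ (proj₁ (principal (X ∩ T)) (trace-isFlat closedX , cutX))
          F⊆Y = proj₂ (proj₁ (principal (Y ∩ T)) (trace-isFlat closedY , cutY))
          _ , cutF = proj₂ (principal F) flatF (λ f → f)
      in ≤-trans (+-monoʳ-≤ (r T) (s≥rD (proj₁ flatF))) (≤-trans cutF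
           (+-monoˡ-≤ (s T) (M.rk-mono-⊆ proj₂ λ f →
             (proj₁ (F⊆X f) , proj₁ (F⊆Y f)) , proj₂ (F⊆X f))))

    pair-collapse : IsOTE T r → r T ≡ 4 →
      rᴱ (X ∩ E) + rᴱ (Y ∩ E) ≤ rᴱ ((X ∪ Y) ∩ E) + rᴱ D →
      (sh : Shape (r (X ∩ T)) (r (Y ∩ T)) (r ((X ∪ Y) ∩ T)) (r ((X ∩ Y) ∩ T))) →
      Collapse sh (s (X ∩ T)) (s (Y ∩ T)) (s ((X ∪ Y) ∩ T)) (s T) (rᴱ D)
    pair-collapse ote rT≡4 modular sh = collapse sh (s-trace-≤ {X}) (s-trace-≤ {Y}) (s-skew modular)
      (s-quotient (λ (x , t) → inj₁ x , t) proj₂)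
      (s-quotient (λ (y , t) → inj₂ y , t) proj₂)
      (subst (λ n → s T + r ((X ∪ Y) ∩ T) ≤ s ((X ∪ Y) ∩ T) + n) rT≡4 (s-quotient proj₂ (λ t → t)))
      (N.rk-mono-⊆ (∪D⊆E (λ t → t)) λ { (inj₁ (_ , t)) → inj₁ t ; (inj₂ d) → inj₂ d })
      (subst (λ n → n + s (X ∩ T) ≤ r (X ∩ T) + s T → n + s (Y ∩ T) ≤ r (Y ∩ T) + s T →
                    n + rᴱ D ≤ r ((X ∩ Y) ∩ T) + s T) rT≡4 (OTE⇒cut-bound ote))

-- The function η on the two extensions together.

module Amalgam {U : Set} {E₁ E₂ : Subset U} {rk rk₁ rk₂ : Subset U → ℕ}
  (M : IsMatroid (E₁ ∩ E₂) rk) (N₁ : IsMatroid E₁ rk₁) (N₂ : IsMatroid E₂ rk₂)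
  (ext₁ : IsExtension (E₁ ∩ E₂) rk E₁ rk₁) (ext₂ : IsExtension (E₁ ∩ E₂) rk E₂ rk₂) where

  private
    T : Subset U
    T = E₁ ∩ E₂
    module M = MatroidProperties M
    module N₁ = MatroidProperties N₁
    module N₂ = MatroidProperties N₂
    module X₁ = Extension M N₁ ext₁
    module X₂ = Extension M N₂ ext₂
    η′ : Subset U → ℕ
    η′ = η E₁ E₂ rk rk₁ rk₂

  η-exact : ∀ X → η′ X + rk (X ∩ T) ≡ rk₁ (X ∩ E₁) + rk₂ (X ∩ E₂)
  η-exact X = m∸n+n≡m (m≤n⇒m≤n+o (rk₂ (X ∩ E₂)) (X₁.rk-trace-≤ X))

  η-lower : ∀ {k} X → k ≤ η′ X → k + rk (X ∩ T) ≤ rk₁ (X ∩ E₁) + rk₂ (X ∩ E₂)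
  η-lower X k≤ = ≤-trans (+-monoˡ-≤ (rk (X ∩ T)) k≤) (≤-reflexive (η-exact X))

  η-mono : ∀ V X → (rk₁ (V ∩ E₁) + rk₂ (V ∩ E₂)) + rk (X ∩ T) ≤
                   (rk₁ (X ∩ E₁) + rk₂ (X ∩ E₂)) + rk (V ∩ T) → η′ V ≤ η′ X
  η-mono V X h = ≤-cancel (rk (V ∩ T) + rk (X ∩ T)) h
    (trans (cong (_+ rk (X ∩ T)) (sym (η-exact V))) (+-assoc (η′ V) _ _))
    (trans (cong (_+ rk (V ∩ T)) (sym (η-exact X)))
      (trans (+-assoc (η′ X) _ _) (cong (η′ X +_) (+-comm (rk (X ∩ T)) _))))

  η-closure₁ : ∀ X → η′ (closure E₁ rk₁ X) ≤ η′ X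
  η-closure₁ X = η-mono V X
    (subst₂ _≤_ (sym (+-assoc (rk₁ (V ∩ E₁)) (rk₂ (V ∩ E₂)) (rk (X ∩ T))))
                (sym (+-assoc (rk₁ (X ∩ E₁)) (rk₂ (X ∩ E₂)) (rk (V ∩ T))))
      (+-mono-≤ (X₁.rk-closure X) (X₂.rk-closure-other {E₁} {rk₁} (λ e₂ e₁ → e₁ , e₂) X)))
    where
    V = closure E₁ rk₁ X

  η-closure₂ : ∀ X → η′ (closure E₂ rk₂ X) ≤ η′ X
  η-closure₂ X = η-mono V X
    (subst₂ _≤_ (rotate (rk₂ (V ∩ E₂)) (rk₁ (V ∩ E₁)) (rk (X ∩ T)))
                (rotate (rk₂ (X ∩ E₂)) (rk₁ (X ∩ E₁)) (rk (V ∩ T)))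
      (+-mono-≤ (X₂.rk-closure X) (X₁.rk-closure-other {E₂} {rk₂} _,_ X)))
    where
    V = closure E₂ rk₂ X
    rotate : ∀ l m n → l + (m + n) ≡ m + l + n
    rotate l m n = solve (l ∷ m ∷ n ∷ [])

  ClosedHull : Subset U → Set₁
  ClosedHull X = ∃ λ V → X ⊆ V × Closed E₁ rk₁ V × Closed E₂ rk₂ V × η′ V ≤ η′ X

  -- The two closures alternate. Closing in `E₂` can spoil closedness in `E₁` only by raising `rk₁`,
  -- which is bounded by `n₁`; the fuel `n` covers the remaining rises.
  closedHull : FiniteRank E₁ rk₁ → ∀ X → ClosedHull X
  closedHull (n₁ , bound) X = go n₁ X (m≤m+n n₁ _)
    where
    go : ∀ n X → n₁ ≤ n + rk₁ (X ∩ E₁) → ClosedHull X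
    go n X n₁≤ = alternate n n₁≤ (rk₁ (W ∩ E₁) ≤? rk₁ (V ∩ E₁))
      where
      V = closure E₁ rk₁ X
      W = closure E₂ rk₂ V
      W≤X : η′ W ≤ η′ X
      W≤X = ≤-trans (η-closure₂ V) (η-closure₁ X)
      rkW≤n₁ : rk₁ (W ∩ E₁) ≤ n₁
      rkW≤n₁ = bound (W ∩ E₁) proj₂
      rkX≤rkV : rk₁ (X ∩ E₁) ≤ rk₁ (V ∩ E₁)
      rkX≤rkV = N₁.rk-mono-⊆ proj₂ λ (x , e) → inj₁ x , e
      alternate : ∀ n → n₁ ≤ n + rk₁ (X ∩ E₁) → Dec (rk₁ (W ∩ E₁) ≤ rk₁ (V ∩ E₁)) → ClosedHull X
      alternate n n₁≤ (yes W≤V) = W , inj₁ ∘ inj₁ ,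
        X₁.Closed-⊆ {X = V} inj₁ W≤V (X₁.closure-closed X (X₁.rk-closure X)) ,
        X₂.closure-closed V (X₂.rk-closure V) , W≤X
      -- Without fuel, `rk₁ (X ∩ E₁)` is already at the bound and cannot rise.
      alternate zero n₁≤ (no W≰V) =
        contradiction (≤-trans (≤-trans rkW≤n₁ n₁≤) rkX≤rkV) W≰V
      alternate (suc n) n₁≤ (no W≰V) =
        let V′ , W⊆V′ , closed₁ , closed₂ , V′≤W = go n W (≤-trans n₁≤
              (≤-trans (≤-reflexive (sym (+-suc n _))) (+-monoʳ-≤ n (≤-trans (s≤s rkX≤rkV) (≰⇒> W≰V)))))
        in V′ , W⊆V′ ∘ inj₁ ∘ inj₁ , closed₁ , closed₂ , ≤-trans V′≤W W≤X

  -- Submodularity at a pair of closed sets.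

  module ClosedPair (ote : IsOTE T rk) (rT≡4 : rk T ≡ 4) {X Y : Subset U}
    (closedX₁ : Closed E₁ rk₁ X) (closedX₂ : Closed E₂ rk₂ X)
    (closedY₁ : Closed E₁ rk₁ Y) (closedY₂ : Closed E₂ rk₂ Y)
    {c e : ℕ} (c≤ : ∀ Z → X ∪ Y ⊆ Z → c ≤ η′ Z) (e≤ : ∀ W → X ∩ Y ⊆ W → e ≤ η′ W) where

    module P₁ = X₁.Pair X Y closedX₁ closedY₁
    module P₂ = X₂.Pair X Y closedX₂ closedY₂

    a = rk (X ∩ T)
    b = rk (Y ∩ T)
    u = rk ((X ∪ Y) ∩ T)
    i = rk ((X ∩ Y) ∩ T)
    x₁ = rk₁ (X ∩ E₁)
    y₁ = rk₁ (Y ∩ E₁)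
    p₁ = rk₁ ((X ∪ Y) ∩ E₁)
    d₁ = rk₁ ((X ∩ Y) ∩ E₁)
    x₂ = rk₂ (X ∩ E₂)
    y₂ = rk₂ (Y ∩ E₂)
    p₂ = rk₂ ((X ∪ Y) ∩ E₂)
    d₂ = rk₂ ((X ∩ Y) ∩ E₂)

    c-bound : c + u ≤ p₁ + p₂
    c-bound = η-lower (X ∪ Y) (c≤ (X ∪ Y) (λ z → z))
    e-bound : e + i ≤ d₁ + d₂
    e-bound = η-lower (X ∩ Y) (e≤ (X ∩ Y) (λ z → z))

    distributes : ∀ (E : Subset U) → (X ∪ Y) ∩ E ⊆ (X ∩ E) ∪ (Y ∩ E)
    distributes _ (inj₁ x , t) = inj₁ (x , t)
    distributes _ (inj₂ y , t) = inj₂ (y , t)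

    submod₁ : p₁ + d₁ ≤ x₁ + y₁
    submod₁ = N₁.rk-submod-⊆ proj₂ proj₂ (distributes E₁) λ ((x , y) , t) → (x , t) , (y , t)
    submod₂ : p₂ + d₂ ≤ x₂ + y₂
    submod₂ = N₂.rk-submod-⊆ proj₂ proj₂ (distributes E₂) λ ((x , y) , t) → (x , t) , (y , t)

    -- The lower bound `c` is tested at `X ∪ Y ∪ T`, whose trace has the full rank 4.
    T-gain : P₁.s T ≤ P₁.s ((X ∪ Y) ∩ T) → P₂.s T ≤ P₂.s ((X ∪ Y) ∩ T) → c + 4 ≤ p₁ + p₂
    T-gain T≤₁ T≤₂ = ≤-trans
      (+-monoʳ-≤ c (subst (_≤ rk ((X ∪ Y ∪ T) ∩ T)) rT≡4 (M.rk-mono-⊆ proj₂ λ t → inj₂ (inj₂ t) , t)))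
      (≤-trans (η-lower (X ∪ Y ∪ T) (c≤ (X ∪ Y ∪ T) [ inj₁ , inj₂ ∘ inj₁ ]))
        (+-mono-≤
          (+-cancelʳ-≤ (P₁.s ((X ∪ Y) ∩ T)) (rk₁ ((X ∪ Y ∪ T) ∩ E₁)) p₁
            (≤-trans P₁.rk-∪-T (+-mono-≤ (≤-refl {p₁}) T≤₁)))
          (+-cancelʳ-≤ (P₂.s ((X ∪ Y) ∩ T)) (rk₂ ((X ∪ Y ∪ T) ∩ E₂)) p₂
            (≤-trans P₂.rk-∪-T (+-mono-≤ (≤-refl {p₂}) T≤₂)))))

    trace-gain : ∀ Z → e + rk (Z ∩ T) ≤ P₁.s (Z ∩ T) + P₂.s (Z ∩ T)
    trace-gain Z = ≤-trans
      (+-monoʳ-≤ e (M.rk-mono-⊆ proj₂ λ z → inj₂ z , proj₂ z))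
      (≤-trans (η-lower ((X ∩ Y) ∪ (Z ∩ T)) (e≤ ((X ∩ Y) ∪ (Z ∩ T)) inj₁))
        (+-mono-≤ (P₁.rk-∩-∪ proj₂) (P₂.rk-∩-∪ proj₂)))

    a≤u : a ≤ u
    a≤u = M.rk-mono-⊆ proj₂ λ (x , t) → inj₁ x , t
    b≤u : b ≤ u
    b≤u = M.rk-mono-⊆ proj₂ λ (y , t) → inj₂ y , t

    shape : ¬ (a + b ≤ u + i) → Shape a b u i
    shape nonmodular = nonmodular-shape
      -- If `u ≤ a`, the trace of `X` contains that of `Y`, and comparable flats form a modular
      -- pair; the next case is symmetric.
      (≰⇒> λ u≤a → nonmodular (+-mono-≤ a≤u (≤-trans
        (X₁.spanned-trace-⊆ {Y} {X} closedX₁ (≤-trans (M.rk-mono-⊆ proj₂ swap-∪) u≤a))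
        (M.rk-mono-⊆ proj₂ λ ((y , x) , t) → (x , y) , t))))
      (≰⇒> λ u≤b → nonmodular (≤-trans
        (+-mono-≤ (X₁.spanned-trace-⊆ {X} {Y} closedY₁ u≤b) b≤u)
        (≤-reflexive (+-comm i u))))
      (subst (u ≤_) rT≡4 (M.rk-mono-⊆ (λ t → t) proj₂))
      (≰⇒> nonmodular)
      where
      swap-∪ : (Y ∪ X) ∩ T ⊆ (X ∪ Y) ∩ T
      swap-∪ (inj₁ y , t) = inj₂ y , t
      swap-∪ (inj₂ x , t) = inj₁ x , t

    conclude : ∀ k → a + b ≤ u + i + k →
      (c + u) + (e + i) + k ≤ (x₁ + y₁) + (x₂ + y₂) → c + e ≤ η′ X + η′ Y
    conclude k deficit = η-balance k {a} {b} {u} {i} {η′ X} {η′ Y} {x₁} {x₂} {y₁} {y₂} {c} {e}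
      deficit (η-exact X) (η-exact Y)

    gain : ∀ n₁ n₂ → n₁ + (p₁ + d₁) ≤ x₁ + y₁ → n₂ + (p₂ + d₂) ≤ x₂ + y₂ →
      (c + u) + (e + i) + (n₁ + n₂) ≤ (x₁ + y₁) + (x₂ + y₂)
    gain n₁ n₂ = modular-gain {c} {u} {e} {i} {p₁} {p₂} {d₁} {d₂} {n₁ = n₁} {n₂} c-bound e-bound

    nonmodular-case : Shape a b u i → Dec (x₁ + y₁ ≤ p₁ + d₁) → Dec (x₂ + y₂ ≤ p₂ + d₂) →
      c + e ≤ η′ X + η′ Y
    nonmodular-case sh = by-sides
      where
      collapse₁⇒deficit : Collapse sh (P₁.s (X ∩ T)) (P₁.s (Y ∩ T)) (P₁.s ((X ∪ Y) ∩ T)) (P₁.s T) d₁ →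
        a + b ≤ u + i + 1
      collapse₁⇒deficit = collapse⇒deficit≤1 {a} {b} {u} {i}
        {P₁.s (X ∩ T)} {P₁.s (Y ∩ T)} {P₁.s ((X ∪ Y) ∩ T)} {P₁.s T} {d₁} sh
      collapse₁ : x₁ + y₁ ≤ p₁ + d₁ →
        Collapse sh (P₁.s (X ∩ T)) (P₁.s (Y ∩ T)) (P₁.s ((X ∪ Y) ∩ T)) (P₁.s T) d₁
      collapse₁ mod₁ = P₁.pair-collapse ote rT≡4 mod₁ sh
      collapse₂⇒deficit : Collapse sh (P₂.s (X ∩ T)) (P₂.s (Y ∩ T)) (P₂.s ((X ∪ Y) ∩ T)) (P₂.s T) d₂ →
        a + b ≤ u + i + 1
      collapse₂⇒deficit = collapse⇒deficit≤1 {a} {b} {u} {i}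
        {P₂.s (X ∩ T)} {P₂.s (Y ∩ T)} {P₂.s ((X ∪ Y) ∩ T)} {P₂.s T} {d₂} sh
      collapse₂ : x₂ + y₂ ≤ p₂ + d₂ →
        Collapse sh (P₂.s (X ∩ T)) (P₂.s (Y ∩ T)) (P₂.s ((X ∪ Y) ∩ T)) (P₂.s T) d₂
      collapse₂ mod₂ = P₂.pair-collapse ote rT≡4 mod₂ sh

      by-sides : Dec (x₁ + y₁ ≤ p₁ + d₁) → Dec (x₂ + y₂ ≤ p₂ + d₂) → c + e ≤ η′ X + η′ Y
      -- Strict submodularity on a side saves one unit, so two strict sides pay for any defect.
      by-sides (no nonmod₁) (no nonmod₂) = conclude 2 (deficit≤2 sh)
        (gain 1 1 (≰⇒> nonmod₁) (≰⇒> nonmod₂))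
      -- The modular side forces a collapse and so defect at most 1, which the strict side pays for.
      by-sides (yes mod₁) (no nonmod₂) = conclude 1 (collapse₁⇒deficit (collapse₁ mod₁))
        (gain 0 1 submod₁ (≰⇒> nonmod₂))
      by-sides (no nonmod₁) (yes mod₂) = conclude 1 (collapse₂⇒deficit (collapse₂ mod₂))
        (gain 1 0 (≰⇒> nonmod₁) submod₂)
      -- Neither side is strict; the unit comes from the collapse on both sides.
      by-sides (yes mod₁) (yes mod₂) = conclude 1 (collapse₁⇒deficit (collapse₁ mod₁))
        (≤-trans
          (collapsed-gain {c = c} {e} {p₁} {p₂} {d₁} {d₂}
              {P₁.s (X ∩ T)} {P₂.s (X ∩ T)} {P₁.s (Y ∩ T)} {P₂.s (Y ∩ T)}
              {P₁.s ((X ∪ Y) ∩ T)} {P₂.s ((X ∪ Y) ∩ T)} {P₁.s T} {P₂.s T} sh (collapse₁ mod₁) (collapse₂ mod₂)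
            c-bound e-bound T-gain (trace-gain X) (trace-gain Y))
          (+-mono-≤ submod₁ submod₂))

    by-modularity : Dec (a + b ≤ u + i) → Dec (x₁ + y₁ ≤ p₁ + d₁) → Dec (x₂ + y₂ ≤ p₂ + d₂) →
      c + e ≤ η′ X + η′ Y
    by-modularity (yes modular) _ _ = conclude 0 (≤-trans modular (m≤m+n _ 0)) (gain 0 0 submod₁ submod₂)
    by-modularity (no nonmodular) mod?₁ mod?₂ = nonmodular-case (shape nonmodular) mod?₁ mod?₂

    closed-submodular : c + e ≤ η′ X + η′ Y
    closed-submodular = by-modularity (a + b ≤? u + i) (x₁ + y₁ ≤? p₁ + d₁) (x₂ + y₂ ≤? p₂ + d₂)

  -- Minimisers for `X` and `Y` are replaced by closed hulls `V` and `W`. Supersets of `V ∪ W` and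
  -- `V ∩ W` also contain `X ∪ Y` and `X ∩ Y`, so `c` and `d` remain lower bounds for η there.
  ξ-submodular : FiniteRank E₁ rk₁ → IsOTE T rk → rk T ≡ 4 → XiSubmodular E₁ E₂ rk rk₁ rk₂
  ξ-submodular finite₁ ote rT≡4
    X Y a b c d ((X′ , X⊆X′ , ηX′≡a) , _) ((Y′ , Y⊆Y′ , ηY′≡b) , _) (_ , c≤) (_ , d≤) =
    via-hulls (closedHull finite₁ X′) (closedHull finite₁ Y′)
    where
    via-hulls : ClosedHull X′ → ClosedHull Y′ → c + d ≤ a + b
    via-hulls (V , X′⊆V , V-closed₁ , V-closed₂ , V≤X′) (W , Y′⊆W , W-closed₁ , W-closed₂ , W≤Y′) = ≤-trans
      (ClosedPair.closed-submodular ote rT≡4 {V} {W} V-closed₁ V-closed₂ W-closed₁ W-closed₂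
        (λ Z ∪⊆Z → c≤ Z [ (λ x → ∪⊆Z (inj₁ (X′⊆V (X⊆X′ x)))) , (λ y → ∪⊆Z (inj₂ (Y′⊆W (Y⊆Y′ y)))) ])
        (λ Z ∩⊆Z → d≤ Z λ (x , y) → ∩⊆Z (X′⊆V (X⊆X′ x) , Y′⊆W (Y⊆Y′ y))))
      (+-mono-≤ (subst (η′ V ≤_) ηX′≡a V≤X′) (subst (η′ W ≤_) ηY′≡b W≤Y′))

theorem16 : (U : Set) → Countable U →
    (E₁ E₂ : Subset U) → (∀ u → u ∈ E₁ ⊎ u ∈ E₂) →
    (rk rk₁ rk₂ : Subset U → ℕ) →
    IsMatroid (E₁ ∩ E₂) rk → IsMatroid E₁ rk₁ → IsMatroid E₂ rk₂ →
    FiniteRank (E₁ ∩ E₂) rk → FiniteRank E₁ rk₁ → FiniteRank E₂ rk₂ →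
    rk (E₁ ∩ E₂) ≡ 4 →
    IsOTE (E₁ ∩ E₂) rk →
    IsExtension (E₁ ∩ E₂) rk E₁ rk₁ → IsExtension (E₁ ∩ E₂) rk E₂ rk₂ →
    XiSubmodular E₁ E₂ rk rk₁ rk₂
theorem16 U _ E₁ E₂ _ rk rk₁ rk₂ M N₁ N₂ _ finite₁ _ rT≡4 ote ext₁ ext₂ =
  Amalgam.ξ-submodular M N₁ N₂ ext₁ ext₂ finite₁ ote rT≡4
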